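{- (1) Any scrutable $\lambda_{\mathsf{Plot}}$-theory (or VSC-theory) $\mathcal T$ that is not semi-scrutable is inconsistent. (2) The set of CbV unsolvable terms is not collapsible.
   Context: Value substitution calculus (VSC). Terms (the set $\Lambda_{\mathsf{vsc}}$) are $t,u,s ::= v \mid tu \mid t[x{\leftarrow}u]$ and values are $v ::= x \mid \lambda x.t$; $t[x{\leftarrow}u]$ is an explicit substitution (ES), binding $x$ in $t$. Terms are identified up to $\alpha$-renaming; $t\{x{\leftarrow}u\}$ is capture-avoiding (meta-level) substitution. Contexts are terms with exactly one hole $\langle\cdot\rangle$; plugging $C\langle t\rangle$ may capture variables. Substitution contexts: $L ::= \langle\cdot\rangle \mid L[x{\leftarrow}t]$. Root rules: $L\langle\lambda x.t\rangle u \mapsto_{\mathsf m} L\langle t[x{\leftarrow}u]\rangle$ and $t[x{\leftarrow}L\langle v\rangle] \mapsto_{\mathsf e} L\langle t\{x{\leftarrow}v\}\rangle$ with $v$ a value, where (by $\alpha$-renaming) $L$ captures no free variable of $u$, resp. of $t$. Full contexts: $F ::= \langle\cdot\rangle \mid Ft \mid tF \mid \lambda x.F \mid F[x{\leftarrow}t] \mid t[x{\leftarrow}F]$. The reduction $\to_{\mathsf{vsc}}$ is the closure of $\mapsto_{\mathsf m}\cup\mapsto_{\mathsf e}$ under full contexts. Plotkin's calculus $\lambda_{\mathsf{Plot}}$. Terms are those of the VSC without ES; reduction is the closure under all contexts (without ES) of $(\lambda x.t)v \mapsto t\{x{\leftarrow}v\}$ with $v$ a value (variable or abstraction). Let $\mathsf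 X$ be $\lambda_{\mathsf{Plot}}$ or VSC. An $\mathsf X$-theory is an equivalence relation on the terms of $\mathsf X$ containing the reduction of $\mathsf X$ and closed under all contexts of $\mathsf X$. It is inconsistent if it equates all terms of $\mathsf X$, consistent otherwise. Testing contexts: $T ::= \langle\cdot\rangle \mid (\lambda x.T)t \mid Tt$. Head contexts: $H ::= \langle\cdot\rangle \mid \lambda x.H \mid Ht$. A term is (CbV) scrutable if some testing context $T$ is such that $T\langle t\rangle\to_{\mathsf{vsc}}^* v$ for some value $v$, and inscrutable otherwise; it is (CbV) solvable if some head context $H$ is such that $H\langle t\rangle\to_{\mathsf{vsc}}^* \lambda x.x$, and unsolvable otherwise. (For terms without ES, using contexts and reduction of $\lambda_{\mathsf{Plot}}$ instead of those of the VSC gives the same notions.) An $\mathsf X$-theory is scrutable if it equates all inscrutable terms of $\mathsf X$; it is semi-scrutable if it never equates a scrutable term and an inscrutable term of $\mathsf X$. A set $U$ of terms of $\mathsf X$ is collapsible if there is a consistent $\mathsf X$-theory equating all terms in $U$; non-collapsibility of CbV unsolvable terms thus means that every $\mathsf X$-theory equating all CbV unsolvable terms of $\mathsf X$ is inconsistent. -}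

module Defs where

open import Data.Nat.Base using (ℕ; zero; suc; _+_)
open import Data.Product.Base using (∃-syntax; _×_)
open import Level using (Level)
open import Relation.Binary.Construct.Closure.ReflexiveTransitive using (Star)
open import Relation.Binary.Core using (Rel)
open import Relation.Binary.Structures using (IsEquivalence)
open import Relation.Nullary.Negation.Core using (¬_)
open import Relation.Unary using (Pred)

data Calculus : Set where
  plot vsc : Calculus

private
  variable
    X : Calculus
    ℓ : Level

infixl 7 _·_
infixl 8 _[←_]

-- Terms up to α-renaming, as unscoped de Bruijn terms: terms may be open, and
-- an index exceeding the number of enclosing binders is a free variable.
-- In the explicit substitution  t [← u ]  index 0 is bound in t, not in u.
data Term : Calculus → Set where
  var   : ℕ → Term X
  ƛ_    : Term X → Term X
  _·_   : Term X → Term X → Term X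
  _[←_] : Term vsc → Term vsc → Term vsc

data Value : Term X → Set where
  var : ∀ i → Value {X} (var i)
  lam : ∀ t → Value {X} (ƛ t)

ext : (ℕ → ℕ) → ℕ → ℕ
ext ρ zero    = zero
ext ρ (suc i) = suc (ρ i)

rename : (ℕ → ℕ) → Term X → Term X
rename ρ (var i)    = var (ρ i)
rename ρ (ƛ t)      = ƛ rename (ext ρ) t
rename ρ (t · u)    = rename ρ t · rename ρ u
rename ρ (t [← u ]) = rename (ext ρ) t [← rename ρ u ]

exts : (ℕ → Term X) → ℕ → Term X
exts σ zero    = var zero
exts σ (suc i) = rename suc (σ i)

subst : (ℕ → Term X) → Term X → Term X
subst σ (var i)    = σ i
subst σ (ƛ t)      = ƛ subst (exts σ) t
subst σ (t · u)    = subst σ t · subst σ u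
subst σ (t [← u ]) = subst (exts σ) t [← subst σ u ]

infixl 8 _❴_❵

-- Meta-level substitution of u for index 0; the remaining indices go down by one.
_❴_❵ : Term X → Term X → Term X
_❴_❵ {X} t u = subst σ t
  where
  σ : ℕ → Term X
  σ zero    = u
  σ (suc i) = var i

data Ctx : Calculus → Set where
  □     : Ctx X
  ƛ_    : Ctx X → Ctx X
  _·ˡ_  : Ctx X → Term X → Ctx X
  _·ʳ_  : Term X → Ctx X → Ctx X
  _[←_]ˡ : Ctx vsc → Term vsc → Ctx vsc
  _[←_]ʳ : Term vsc → Ctx vsc → Ctx vsc

infix 6 _⟨_⟩

-- Plugging does not rename: the binders of the context crossing the hole
-- capture the corresponding indices of t.
_⟨_⟩ : Ctx X → Term X → Term X
□            ⟨ t ⟩ = t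
(ƛ C)        ⟨ t ⟩ = ƛ (C ⟨ t ⟩)
(C ·ˡ u)     ⟨ t ⟩ = (C ⟨ t ⟩) · u
(u ·ʳ C)     ⟨ t ⟩ = u · (C ⟨ t ⟩)
(C [← u ]ˡ)  ⟨ t ⟩ = (C ⟨ t ⟩) [← u ]
(u [← C ]ʳ)  ⟨ t ⟩ = u [← (C ⟨ t ⟩) ]

data SubstCtx : Set where
  □     : SubstCtx
  _[←_] : SubstCtx → Term vsc → SubstCtx

infix 6 _⟨_⟩ˢ

_⟨_⟩ˢ : SubstCtx → Term vsc → Term vsc
□          ⟨ t ⟩ˢ = t
(L [← u ]) ⟨ t ⟩ˢ = (L ⟨ t ⟩ˢ) [← u ]

depth : SubstCtx → ℕ
depth □          = zero
depth (L [← _ ]) = suc (depth L)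

infix 4 _↦_ _⟶_ _⟶*_

-- A term moved under L has its free indices shifted by  depth L , which is the
-- side condition that L captures none of its free variables. In rule e the
-- shift is under one binder, because index 0 of t is the substituted variable.
data _↦_ : Term X → Term X → Set where
  β : ∀ {t v : Term plot} → Value v →
      (ƛ t) · v ↦ t ❴ v ❵
  m : ∀ L {t u : Term vsc} →
      (L ⟨ ƛ t ⟩ˢ) · u ↦ L ⟨ t [← rename (depth L +_) u ] ⟩ˢ
  e : ∀ L {t v : Term vsc} → Value v →
      t [← (L ⟨ v ⟩ˢ) ] ↦ L ⟨ rename (ext (depth L +_)) t ❴ v ❵ ⟩ˢ

data _⟶_ : Term X → Term X → Set where
  closure : ∀ (C : Ctx X) {t u : Term X} → t ↦ u → C ⟨ t ⟩ ⟶ C ⟨ u ⟩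

_⟶*_ : Term X → Term X → Set
_⟶*_ = Star _⟶_

data Testing : Ctx vsc → Set where
  □    : Testing □
  bind : ∀ {T} → Testing T → ∀ t → Testing ((ƛ T) ·ˡ t)
  app  : ∀ {T} → Testing T → ∀ t → Testing (T ·ˡ t)

data Head : Ctx vsc → Set where
  □   : Head □
  lam : ∀ {H} → Head H → Head (ƛ H)
  app : ∀ {H} → Head H → ∀ t → Head (H ·ˡ t)

-- The inclusion of the terms of either calculus into those of the VSC
-- (the identity on VSC terms).
⌈_⌉ : Term X → Term vsc
⌈ var i ⌉    = var i
⌈ ƛ t ⌉      = ƛ ⌈ t ⌉
⌈ t · u ⌉    = ⌈ t ⌉ · ⌈ u ⌉
⌈ t [← u ] ⌉ = ⌈ t ⌉ [← ⌈ u ⌉ ]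

-- Also for terms without ES, these notions use the contexts and the reduction
-- of the VSC.
Scrutable Inscrutable Solvable Unsolvable : Term X → Set
Scrutable t   = ∃[ T ] Testing T × ∃[ v ] Value v × (T ⟨ ⌈ t ⌉ ⟩ ⟶* v)
Inscrutable t = ¬ Scrutable t
Solvable t    = ∃[ H ] Head H × (H ⟨ ⌈ t ⌉ ⟩ ⟶* ƛ var 0)
Unsolvable t  = ¬ Solvable t

record IsTheory (_≈_ : Rel (Term X) ℓ) : Set ℓ where
  field
    isEquivalence : IsEquivalence _≈_
    reduction     : ∀ {t u} → t ⟶ u → t ≈ u
    contextual    : ∀ (C : Ctx X) {t u} → t ≈ u → (C ⟨ t ⟩) ≈ (C ⟨ u ⟩)

Inconsistent : Rel (Term X) ℓ → Set ℓ
Inconsistent _≈_ = ∀ t u → t ≈ u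

Equates : ∀ {ℓ′} → Rel (Term X) ℓ → Pred (Term X) ℓ′ → Set _
Equates _≈_ U = ∀ t u → U t → U u → t ≈ u

ScrutableTheory : Rel (Term X) ℓ → Set ℓ
ScrutableTheory _≈_ = Equates _≈_ Inscrutable

SemiScrutable : Rel (Term X) ℓ → Set ℓ
SemiScrutable _≈_ = ∀ t u → Scrutable t → Inscrutable u → ¬ (t ≈ u)

{-# OPTIONS --safe #-}

-- Let Ω = (λx.xx)(λx.xx). In any theory equating a value v with Ω, every t is
-- equal to (λx.t) v, hence to (λx.t) Ω; if moreover Ω and (λx.t) Ω are equated
-- for all t, then the theory is inconsistent. Both terms are inscrutable and
-- unsolvable, since having Ω in evaluation position is invariant under full
-- reduction and substitution. When unsolvables are equated, v = λx.Ω will do.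
-- When a scrutable t is equated with an inscrutable u, a testing context takes t
-- to a value v and u to an inscrutable term, hence to Ω. In Plotkin's calculus
-- that context must be obtained from a VSC one: as values are typable, subject
-- expansion gives an intersection type to every term reducing to a value, and by
-- realizability the type yields an equality with a value in Plotkin's calculus.

module Submission where

open import Defs
open import Axiom.ExcludedMiddle using (ExcludedMiddle)
open import Data.Empty using (⊥)
open import Data.List.Base using (List; []; _∷_; _++_; [_])
open import Data.List.Membership.Propositional using (_∈_)
open import Data.List.Membership.Propositional.Properties using (∈-++⁻)
open import Data.List.Relation.Binary.Subset.Propositional using (_⊆_)
open import Data.List.Relation.Binary.Subset.Propositional.Properties
  using (⊆-reflexive; xs⊆xs++ys; xs⊆ys++xs)
open import Data.List.Relation.Unary.Any using (here; there)
open import Data.Nat.Base using (ℕ; zero; suc; _+_)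
open import Data.Nat.Properties using (+-suc)
open import Data.Product.Base using (_×_; _,_; ∃; ∃₂; ∃-syntax; proj₁; proj₂)
open import Data.Sum.Base using (_⊎_; inj₁; inj₂; [_,_]′)
open import Function.Base using (_∘_; id)
open import Level using (Level; Lift; lift)
open import Relation.Binary.Construct.Closure.ReflexiveTransitive using (ε; _◅_)
open import Relation.Binary.Core using (Rel)
open import Relation.Binary.PropositionalEquality
  using (_≡_; _≗_; refl; sym; trans; cong; cong₂; module ≡-Reasoning)
  renaming (subst to transport)
open import Relation.Binary.Structures using (IsEquivalence)
open import Relation.Nullary.Decidable.Core using (yes; no)
open import Relation.Nullary.Negation.Core using (¬_; contradiction)

private
  variable
    X : Calculus
    ℓ : Level

-- Substitution

infixr 6 _•_

_•_ : ∀ {a} {A : Set a} → A → (ℕ → A) → ℕ → A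
(x • f) zero    = x
(x • f) (suc i) = f i

exts-cong : ∀ {σ τ : ℕ → Term X} → σ ≗ τ → exts σ ≗ exts τ
exts-cong p zero    = refl
exts-cong p (suc i) = cong (rename suc) (p i)

subst-cong : ∀ {σ τ : ℕ → Term X} → σ ≗ τ → subst σ ≗ subst τ
subst-cong p (var i)    = p i
subst-cong p (ƛ t)      = cong ƛ_ (subst-cong (exts-cong p) t)
subst-cong p (t · u)    = cong₂ _·_ (subst-cong p t) (subst-cong p u)
subst-cong p (t [← u ]) = cong₂ _[←_] (subst-cong (exts-cong p) t) (subst-cong p u)

exts-var : exts {X} var ≗ var
exts-var zero    = refl
exts-var (suc i) = refl

subst-var : (t : Term X) → subst var t ≡ t
subst-var (var i)    = refl
subst-var (ƛ t)      = cong ƛ_ (trans (subst-cong exts-var t) (subst-var t))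
subst-var (t · u)    = cong₂ _·_ (subst-var t) (subst-var u)
subst-var (t [← u ]) =
  cong₂ _[←_] (trans (subst-cong exts-var t) (subst-var t)) (subst-var u)

ext-∘ : ∀ {f g h : ℕ → ℕ} → g ∘ f ≗ h → ext g ∘ ext f ≗ ext h
ext-∘ p zero    = refl
ext-∘ p (suc i) = cong suc (p i)

rename-rename : ∀ {f g h : ℕ → ℕ} → g ∘ f ≗ h →
                (t : Term X) → rename g (rename f t) ≡ rename h t
rename-rename p (var i)    = cong var (p i)
rename-rename p (ƛ t)      = cong ƛ_ (rename-rename (ext-∘ p) t)
rename-rename p (t · u)    = cong₂ _·_ (rename-rename p t) (rename-rename p u)
rename-rename p (t [← u ]) =
  cong₂ _[←_] (rename-rename (ext-∘ p) t) (rename-rename p u)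

rename-suc : ∀ f (t : Term X) →
             rename (ext f) (rename suc t) ≡ rename suc (rename f t)
rename-suc f t = trans (rename-rename (λ _ → refl) t)
                       (sym (rename-rename (λ _ → refl) t))

exts-∘-ext : ∀ {f} {σ τ : ℕ → Term X} → σ ∘ f ≗ τ → exts σ ∘ ext f ≗ exts τ
exts-∘-ext p zero    = refl
exts-∘-ext p (suc i) = cong (rename suc) (p i)

subst-rename : ∀ {f} {σ τ : ℕ → Term X} → σ ∘ f ≗ τ →
               ∀ t → subst σ (rename f t) ≡ subst τ t
subst-rename p (var i)    = p i
subst-rename p (ƛ t)      = cong ƛ_ (subst-rename (exts-∘-ext p) t)
subst-rename p (t · u)    = cong₂ _·_ (subst-rename p t) (subst-rename p u)
subst-rename p (t [← u ]) =
  cong₂ _[←_] (subst-rename (exts-∘-ext p) t) (subst-rename p u)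

ext-∘-exts : ∀ {f} {σ τ : ℕ → Term X} →
             rename f ∘ σ ≗ τ → rename (ext f) ∘ exts σ ≗ exts τ
ext-∘-exts p zero    = refl
ext-∘-exts p (suc i) = trans (rename-suc _ _) (cong (rename suc) (p i))

rename-subst : ∀ {f} {σ τ : ℕ → Term X} → rename f ∘ σ ≗ τ →
               ∀ t → rename f (subst σ t) ≡ subst τ t
rename-subst p (var i)    = p i
rename-subst p (ƛ t)      = cong ƛ_ (rename-subst (ext-∘-exts p) t)
rename-subst p (t · u)    = cong₂ _·_ (rename-subst p t) (rename-subst p u)
rename-subst p (t [← u ]) =
  cong₂ _[←_] (rename-subst (ext-∘-exts p) t) (rename-subst p u)

exts-suc : ∀ (σ : ℕ → Term X) t →
           subst (exts σ) (rename suc t) ≡ rename suc (subst σ t)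
exts-suc σ t = trans (subst-rename (λ _ → refl) t)
                     (sym (rename-subst (λ _ → refl) t))

exts-∘-exts : ∀ {σ τ υ : ℕ → Term X} →
              subst τ ∘ σ ≗ υ → subst (exts τ) ∘ exts σ ≗ exts υ
exts-∘-exts             p zero    = refl
exts-∘-exts {σ = σ} {τ} p (suc i) = trans (exts-suc τ (σ i)) (cong (rename suc) (p i))

subst-subst : ∀ {σ τ υ : ℕ → Term X} → subst τ ∘ σ ≗ υ →
              ∀ t → subst τ (subst σ t) ≡ subst υ t
subst-subst p (var i)    = p i
subst-subst p (ƛ t)      = cong ƛ_ (subst-subst (exts-∘-exts p) t)
subst-subst p (t · u)    = cong₂ _·_ (subst-subst p t) (subst-subst p u)
subst-subst p (t [← u ]) =
  cong₂ _[←_] (subst-subst (exts-∘-exts p) t) (subst-subst p u)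

❴❵-subst : ∀ (t u : Term X) → t ❴ u ❵ ≡ subst (u • var) t
❴❵-subst t u = subst-cong (λ { zero → refl ; (suc i) → refl }) t

exts-❴❵ : ∀ (σ : ℕ → Term X) t u → subst (exts σ) t ❴ u ❵ ≡ subst (u • σ) t
exts-❴❵ σ t u = trans (❴❵-subst (subst (exts σ) t) u) (subst-subst eq t)
  where
  eq : subst (u • var) ∘ exts σ ≗ u • σ
  eq zero    = refl
  eq (suc i) = trans (subst-rename (λ _ → refl) (σ i)) (subst-var (σ i))

-- Rule `e` at the empty substitution context leaves a renaming `ext (0 +_)`, which is the identity
-- only pointwise. As index 0 does not occur in `rename suc t`, agreement on successors suffices.
rename-❴❵ : ∀ {f} → (∀ i → f (suc i) ≡ suc i) →
            ∀ (t u : Term X) → rename f (rename suc t) ❴ u ❵ ≡ t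
rename-❴❵ {f = f} p t u = begin
  rename f (rename suc t) ❴ u ❵             ≡⟨ ❴❵-subst (rename f (rename suc t)) u ⟩
  subst (u • var) (rename f (rename suc t)) ≡⟨ subst-rename (λ _ → refl) (rename suc t) ⟩
  subst ((u • var) ∘ f) (rename suc t)      ≡⟨ subst-rename (λ i → cong (u • var) (p i)) t ⟩
  subst var t                               ≡⟨ subst-var t ⟩
  t                                         ∎
  where open ≡-Reasoning

suc-❴❵ : ∀ (t u : Term X) → rename suc t ❴ u ❵ ≡ t
suc-❴❵ t u =
  trans (❴❵-subst (rename suc t) u) (trans (subst-rename (λ _ → refl) t) (subst-var t))

-- Divergence

δ : Term X
δ = ƛ (var 0 · var 0)

Ω : Term X
Ω = δ · δ

-- Diverges k t : applied to k arguments, t has a subterm in evaluation position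
-- that is Ω or its reduct (x x)[x←δ].
Diverges : ℕ → Term vsc → Set
Diverges k       (var i)    = ⊥
Diverges zero    (ƛ t)      = ⊥
Diverges (suc k) (ƛ t)      = Diverges k t
Diverges k       (t · u)    =
  (Diverges (suc k) t ⊎ Diverges 0 u) ⊎ (t ≡ δ × u ≡ δ)
Diverges k       (t [← u ]) =
  (Diverges k t ⊎ Diverges 0 u) ⊎ (t ≡ var 0 · var 0 × u ≡ δ)

-- A further argument can only uncover more evaluation positions.
Diverges-suc : ∀ k t → Diverges k t → Diverges (suc k) t
Diverges-suc zero    (ƛ t)      ()
Diverges-suc (suc k) (ƛ t)      d               = Diverges-suc k t d
Diverges-suc k       (t · u)    (inj₁ (inj₁ d)) = inj₁ (inj₁ (Diverges-suc (suc k) t d))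
Diverges-suc k       (t · u)    (inj₁ (inj₂ d)) = inj₁ (inj₂ d)
Diverges-suc k       (t · u)    (inj₂ ω)        = inj₂ ω
Diverges-suc k       (t [← u ]) (inj₁ (inj₁ d)) = inj₁ (inj₁ (Diverges-suc k t d))
Diverges-suc k       (t [← u ]) (inj₁ (inj₂ d)) = inj₁ (inj₂ d)
Diverges-suc k       (t [← u ]) (inj₂ ω)        = inj₂ ω

Diverges-rename : ∀ k f t → Diverges k t → Diverges k (rename f t)
Diverges-rename zero    f (ƛ t)      ()
Diverges-rename (suc k) f (ƛ t)      d                    = Diverges-rename k _ t d
Diverges-rename k       f (t · u)    (inj₁ (inj₁ d))      =
  inj₁ (inj₁ (Diverges-rename (suc k) f t d))
Diverges-rename k       f (t · u)    (inj₁ (inj₂ d))      =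
  inj₁ (inj₂ (Diverges-rename 0 f u d))
Diverges-rename k       f (t · u)    (inj₂ (refl , refl)) = inj₂ (refl , refl)
Diverges-rename k       f (t [← u ]) (inj₁ (inj₁ d))      =
  inj₁ (inj₁ (Diverges-rename k _ t d))
Diverges-rename k       f (t [← u ]) (inj₁ (inj₂ d))      =
  inj₁ (inj₂ (Diverges-rename 0 f u d))
Diverges-rename k       f (t [← u ]) (inj₂ (refl , refl)) = inj₂ (refl , refl)

Diverges-subst : ∀ k σ t → Diverges k t → Diverges k (subst σ t)
Diverges-subst zero    σ (ƛ t)      ()
Diverges-subst (suc k) σ (ƛ t)      d                    = Diverges-subst k _ t d
Diverges-subst k       σ (t · u)    (inj₁ (inj₁ d))      =
  inj₁ (inj₁ (Diverges-subst (suc k) σ t d))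
Diverges-subst k       σ (t · u)    (inj₁ (inj₂ d))      =
  inj₁ (inj₂ (Diverges-subst 0 σ u d))
Diverges-subst k       σ (t · u)    (inj₂ (refl , refl)) = inj₂ (refl , refl)
Diverges-subst k       σ (t [← u ]) (inj₁ (inj₁ d))      =
  inj₁ (inj₁ (Diverges-subst k _ t d))
Diverges-subst k       σ (t [← u ]) (inj₁ (inj₂ d))      =
  inj₁ (inj₂ (Diverges-subst 0 σ u d))
Diverges-subst k       σ (t [← u ]) (inj₂ (refl , refl)) = inj₂ (refl , refl)

Diverges-⟨⟩ˢ : ∀ L {k t} → Diverges k t → Diverges k (L ⟨ t ⟩ˢ)
Diverges-⟨⟩ˢ □          d = d
Diverges-⟨⟩ˢ (L [← u ]) d = inj₁ (inj₁ (Diverges-⟨⟩ˢ L d))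

⟨value⟩ˢ≢var·var : ∀ L {v i j} → Value v → ¬ (L ⟨ v ⟩ˢ ≡ var i · var j)
⟨value⟩ˢ≢var·var □ () refl

⟨⟩ˢ≡δ : ∀ L {t} → L ⟨ t ⟩ˢ ≡ δ → L ≡ □ × t ≡ δ
⟨⟩ˢ≡δ □ eq = refl , eq

-- The divergence lies either in an argument held by `L`, and then survives any change of the
-- plugged term and of `k`, or in `v`.
Diverges-⟨⟩ˢ⁻ : ∀ L {k v} → Value v → Diverges k (L ⟨ v ⟩ˢ) →
                (∀ j t → Diverges j (L ⟨ t ⟩ˢ)) ⊎ Diverges k v
Diverges-⟨⟩ˢ⁻ □          V d               = inj₂ d
Diverges-⟨⟩ˢ⁻ (L [← u ]) V (inj₁ (inj₁ d)) with Diverges-⟨⟩ˢ⁻ L V d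
... | inj₁ l = inj₁ λ j t → inj₁ (inj₁ (l j t))
... | inj₂ d = inj₂ d
Diverges-⟨⟩ˢ⁻ (L [← u ]) V (inj₁ (inj₂ d)) = inj₁ λ _ _ → inj₁ (inj₂ d)
Diverges-⟨⟩ˢ⁻ (L [← u ]) V (inj₂ (eq , _)) = contradiction eq (⟨value⟩ˢ≢var·var L V)

¬Diverges-value : ∀ {v} → Value v → ¬ Diverges 0 v
¬Diverges-value (var i) ()
¬Diverges-value (lam t) ()

-- In rule `m` the abstraction consumes the extra argument that `Diverges` grants it. In rule `e` a
-- value does not diverge at 0, so divergence of the argument sits in `L`. `Ω` steps to
-- `(x x)[x←δ]`, and that back to `Ω`.
Diverges-↦ : ∀ {t u} k → t ↦ u → Diverges k t → Diverges k u
Diverges-↦ k (m L {t} {u}) (inj₁ (inj₁ d)) with Diverges-⟨⟩ˢ⁻ L (lam t) d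
... | inj₁ l = l k _
... | inj₂ d = Diverges-⟨⟩ˢ L (inj₁ (inj₁ d))
Diverges-↦ k (m L {t} {u}) (inj₁ (inj₂ d)) =
  Diverges-⟨⟩ˢ L (inj₁ (inj₂ (Diverges-rename 0 _ u d)))
Diverges-↦ k (m L) (inj₂ (eq , refl)) with refl , refl ← ⟨⟩ˢ≡δ L eq = inj₂ (refl , refl)
Diverges-↦ k (e L {t} V) (inj₁ (inj₁ d)) =
  Diverges-⟨⟩ˢ L (Diverges-subst k _ (rename (ext (depth L +_)) t)
                   (Diverges-rename k _ t d))
Diverges-↦ k (e L V) (inj₁ (inj₂ d)) with Diverges-⟨⟩ˢ⁻ L V d
... | inj₁ l = l k _
... | inj₂ d = contradiction d (¬Diverges-value V)
Diverges-↦ k (e L V) (inj₂ (refl , eq)) with refl , refl ← ⟨⟩ˢ≡δ L eq = inj₂ (refl , refl)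

ƛ-injective : ∀ {t u : Term X} → ƛ t ≡ ƛ u → t ≡ u
ƛ-injective refl = refl

·-injective : ∀ {t t′ u u′ : Term X} → t · u ≡ t′ · u′ → t ≡ t′ × u ≡ u′
·-injective refl = refl , refl

¬var↦ : ∀ (C : Ctx vsc) {i t u} → C ⟨ t ⟩ ≡ var i → ¬ (t ↦ u)
¬var↦ □ refl ()

¬var·var↦ : ∀ (C : Ctx vsc) {i j t u} → C ⟨ t ⟩ ≡ var i · var j → ¬ (t ↦ u)
¬var·var↦ □        eq   (m □)          with () ← eq
¬var·var↦ □        eq   (m (L [← x ])) with () ← eq
¬var·var↦ (C ·ˡ u) eq   r = ¬var↦ C (proj₁ (·-injective eq)) r
¬var·var↦ (u ·ʳ C) eq   r = ¬var↦ C (proj₂ (·-injective eq)) r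

¬δ↦ : ∀ (C : Ctx vsc) {t u} → C ⟨ t ⟩ ≡ δ → ¬ (t ↦ u)
¬δ↦ □     eq   (m L) with () ← eq
¬δ↦ □     eq   (e L V) with () ← eq
¬δ↦ (ƛ C) eq   r     = ¬var·var↦ C (ƛ-injective eq) r

-- `Ω` and its reduct are recognised by syntactic equality, which a step strictly inside them would
-- destroy; there is none, as `δ` and `x x` are normal.
Diverges-ctx : ∀ C {t u} k → t ↦ u → Diverges k (C ⟨ t ⟩) → Diverges k (C ⟨ u ⟩)
Diverges-ctx □            k       r d = Diverges-↦ k r d
Diverges-ctx (ƛ C)        (suc k) r d = Diverges-ctx C k r d
Diverges-ctx (C ·ˡ s)     k r (inj₁ (inj₁ d))   = inj₁ (inj₁ (Diverges-ctx C (suc k) r d))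
Diverges-ctx (C ·ˡ s)     k r (inj₁ (inj₂ d))   = inj₁ (inj₂ d)
Diverges-ctx (C ·ˡ s)     k r (inj₂ (eq , _))   = contradiction r (¬δ↦ C eq)
Diverges-ctx (s ·ʳ C)     k r (inj₁ (inj₁ d))   = inj₁ (inj₁ d)
Diverges-ctx (s ·ʳ C)     k r (inj₁ (inj₂ d))   = inj₁ (inj₂ (Diverges-ctx C 0 r d))
Diverges-ctx (s ·ʳ C)     k r (inj₂ (_ , eq))   = contradiction r (¬δ↦ C eq)
Diverges-ctx (C [← s ]ˡ)  k r (inj₁ (inj₁ d))   = inj₁ (inj₁ (Diverges-ctx C k r d))
Diverges-ctx (C [← s ]ˡ)  k r (inj₁ (inj₂ d))   = inj₁ (inj₂ d)
Diverges-ctx (C [← s ]ˡ)  k r (inj₂ (eq , _))   = contradiction r (¬var·var↦ C eq)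
Diverges-ctx (s [← C ]ʳ)  k r (inj₁ (inj₁ d))   = inj₁ (inj₁ d)
Diverges-ctx (s [← C ]ʳ)  k r (inj₁ (inj₂ d))   = inj₁ (inj₂ (Diverges-ctx C 0 r d))
Diverges-ctx (s [← C ]ʳ)  k r (inj₂ (_ , eq))   = contradiction r (¬δ↦ C eq)

Diverges-⟶* : ∀ {t u} k → t ⟶* u → Diverges k t → Diverges k u
Diverges-⟶* k ε                 d = d
Diverges-⟶* k (closure C r ◅ rs) d = Diverges-⟶* k rs (Diverges-ctx C k r d)

Diverges-testing : ∀ {T} → Testing T → ∀ t → Diverges 0 t → Diverges 0 (T ⟨ t ⟩)
Diverges-testing □            t d = d
Diverges-testing (bind isT u) t d = inj₁ (inj₁ (Diverges-testing isT t d))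
Diverges-testing (app {T} isT u) t d =
  inj₁ (inj₁ (Diverges-suc 0 (T ⟨ t ⟩) (Diverges-testing isT t d)))

-- A head context may abstract over the hole without supplying an argument, so the number of
-- arguments has to vary; in a testing context every abstraction is applied, and 0 persists.
Diverges-head : ∀ {H} → Head H → ∀ t → ∃ (λ k → Diverges k t) →
                ∃ λ k → Diverges k (H ⟨ t ⟩)
Diverges-head □               t d = d
Diverges-head (lam isH)       t d with k , d′ ← Diverges-head isH t d = suc k , d′
Diverges-head (app {H} isH u) t d with k , d′ ← Diverges-head isH t d =
  k , inj₁ (inj₁ (Diverges-suc k (H ⟨ t ⟩) d′))

diverges⇒inscrutable : ∀ (t : Term X) → Diverges 0 ⌈ t ⌉ → Inscrutable t
diverges⇒inscrutable t d (T , isT , v , V , rs) =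
  ¬Diverges-value V (Diverges-⟶* 0 rs (Diverges-testing isT ⌈ t ⌉ d))

diverges⇒unsolvable : ∀ (t : Term X) k → Diverges k ⌈ t ⌉ → Unsolvable t
diverges⇒unsolvable t k d (H , isH , rs) with Diverges-head isH ⌈ t ⌉ (k , d)
... | zero  , d′ with () ← Diverges-⟶* 0 rs d′
... | suc k , d′ with () ← Diverges-⟶* (suc k) rs d′

-- Intersection types

-- A term has a finite intersection of arrow types; [] is the type of all values.
data Arrow : Set where
  _⇒_ : List Arrow → List Arrow → Arrow

Type : Set
Type = List Arrow

private
  variable
    A B : Type
    Γ Δ : ℕ → Type

infix 4 _⊢_∶_

-- Call-by-value typing: an argument carries a whole intersection, an abstraction needs one
-- derivation per arrow, and `[]` comes for free to values only. Subsumption is confined to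
-- variables.
data _⊢_∶_ (Γ : ℕ → Type) : Term vsc → Type → Set where
  var  : ∀ {i} → A ⊆ Γ i → Γ ⊢ var i ∶ A
  lam  : ∀ {t} → Γ ⊢ ƛ t ∶ []
  _∷_  : ∀ {t As} → A • Γ ⊢ t ∶ B → Γ ⊢ ƛ t ∶ As → Γ ⊢ ƛ t ∶ (A ⇒ B) ∷ As
  _·_  : ∀ {t u} → Γ ⊢ t ∶ [ A ⇒ B ] → Γ ⊢ u ∶ A → Γ ⊢ t · u ∶ B
  _⟦_⟧ : ∀ {t u} → A • Γ ⊢ t ∶ B → Γ ⊢ u ∶ A → Γ ⊢ t [← u ] ∶ B

infix 4 _⊑_

_⊑_ : (ℕ → Type) → (ℕ → Type) → Set
Γ ⊑ Δ = ∀ i → Γ i ⊆ Δ i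

•-mono : A ⊆ B → Γ ⊑ Δ → A • Γ ⊑ B • Δ
•-mono p q zero    = p
•-mono p q (suc i) = q i

weaken : ∀ {t} → Γ ⊑ Δ → Γ ⊢ t ∶ A → Δ ⊢ t ∶ A
weaken p (var q)   = var (p _ ∘ q)
weaken p lam       = lam
weaken p (d ∷ ds)  = weaken (•-mono id p) d ∷ weaken p ds
weaken p (d · d′)  = weaken p d · weaken p d′
weaken p (d ⟦ d′ ⟧) = weaken (•-mono id p) d ⟦ weaken p d′ ⟧

•-∘-ext : ∀ {f} → Γ ∘ f ⊑ Δ → (A • Γ) ∘ ext f ⊑ A • Δ
•-∘-ext p zero    = id
•-∘-ext p (suc i) = p i

rename⁻ : ∀ {f} → Γ ∘ f ⊑ Δ → ∀ t → Γ ⊢ rename f t ∶ A → Δ ⊢ t ∶ A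
rename⁻ p (var i)    (var q)    = var (p i ∘ q)
rename⁻ p (ƛ t)      lam        = lam
rename⁻ p (ƛ t)      (d ∷ ds)   = rename⁻ (•-∘-ext p) t d ∷ rename⁻ p (ƛ t) ds
rename⁻ p (t · u)    (d · d′)   = rename⁻ p t d · rename⁻ p u d′
rename⁻ p (t [← u ]) (d ⟦ d′ ⟧) = rename⁻ (•-∘-ext p) t d ⟦ rename⁻ p u d′ ⟧

value-[] : ∀ {v} → Value v → Γ ⊢ v ∶ []
value-[] (var i) = var λ ()
value-[] (lam t) = lam

++-⊆ : ∀ {C : Type} → A ⊆ C → B ⊆ C → A ++ B ⊆ C
++-⊆ {A = A} p q = [ p , q ]′ ∘ ∈-++⁻ A

value-++ : ∀ {v} → Value v → Γ ⊢ v ∶ A → Γ ⊢ v ∶ B → Γ ⊢ v ∶ A ++ B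
value-++ (var i) (var p)  (var q) = var (++-⊆ p q)
value-++ (lam t) lam      d′      = d′
value-++ (lam t) (d ∷ ds) d′      = d ∷ value-++ (lam t) ds d′

-- Anti-substitution

infix 4 _⊩_∶_

_⊩_∶_ : (ℕ → Type) → (ℕ → Term vsc) → (ℕ → Type) → Set
Γ ⊩ σ ∶ Δ = ∀ i → Γ ⊢ σ i ∶ Δ i

Valued : (ℕ → Term X) → Set
Valued σ = ∀ i → Value (σ i)

rename-value : ∀ {f} {v : Term X} → Value v → Value (rename f v)
rename-value (var i) = var _
rename-value (lam t) = lam _

exts-valued : ∀ {σ : ℕ → Term X} → Valued σ → Valued (exts σ)
exts-valued V zero    = var zero
exts-valued V (suc i) = rename-value (V i)

merge : ∀ {σ Δ Δ′} → Valued σ → Γ ⊩ σ ∶ Δ → Γ ⊩ σ ∶ Δ′ →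
        Γ ⊩ σ ∶ λ i → Δ i ++ Δ′ i
merge V s s′ i = value-++ (V i) (s i) (s′ i)

merge-⊑ˡ : Γ ⊑ λ i → Γ i ++ Δ i
merge-⊑ˡ {Γ} {Δ} i = xs⊆xs++ys (Γ i) (Δ i)

merge-⊑ʳ : Δ ⊑ λ i → Γ i ++ Δ i
merge-⊑ʳ {Δ} {Γ} i = xs⊆ys++xs (Δ i) (Γ i)

single : ℕ → Type → ℕ → Type
single zero    A = A • λ _ → []
single (suc i) A = [] • single i A

single-self : ∀ i → A ⊆ single i A i
single-self zero    = id
single-self (suc i) = single-self i

single-⊩ : ∀ i {σ} → Valued σ → Γ ⊢ σ i ∶ A → Γ ⊩ σ ∶ single i A
single-⊩ zero    V d zero    = d
single-⊩ zero    V d (suc j) = value-[] (V (suc j))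
single-⊩ (suc i) V d zero    = value-[] (V zero)
single-⊩ (suc i) V d (suc j) = single-⊩ i (V ∘ suc) d j

-- `exts σ` keeps index 0 as a variable, so its demand in `Δ` is bounded by `A`; the other entries
-- are weakened, and their types go back along `suc`.
under⁻ : ∀ {σ} → A • Γ ⊩ exts σ ∶ Δ → Δ ⊑ A • (Δ ∘ suc) × Γ ⊩ σ ∶ Δ ∘ suc
under⁻ {σ = σ} s = mono , λ i → rename⁻ (λ _ → id) (σ i) (s (suc i))
  where
  mono : _ ⊑ _
  mono zero    with var p ← s zero = p
  mono (suc i) = id

-- `Δ` intersects the types at which the occurrences of each variable are used, and gives `[]` to
-- absent variables. Both rely on `σ` consisting of values.
subst⁻ : ∀ t {σ} → Valued σ → Γ ⊢ subst σ t ∶ A → ∃[ Δ ] Γ ⊩ σ ∶ Δ × Δ ⊢ t ∶ A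
subst⁻ (var i) V d = single i _ , single-⊩ i V d , var (single-self i)
subst⁻ (ƛ t) V lam = (λ _ → []) , (λ i → value-[] (V i)) , lam
subst⁻ (ƛ t) V (d ∷ ds)
  with Δ , s , d′ ← subst⁻ t (exts-valued V) d | Δ′ , s′ , ds′ ← subst⁻ (ƛ t) V ds
  with p , s ← under⁻ s =
  _ , merge V s s′ ,
  weaken (λ { zero → p zero ; (suc i) → xs⊆xs++ys _ _ }) d′ ∷
  weaken (merge-⊑ʳ {Γ = Δ ∘ suc}) ds′
subst⁻ (t · u) V (d · d′)
  with Δ , s , d ← subst⁻ t V d | Δ′ , s′ , d′ ← subst⁻ u V d′ =
  _ , merge V s s′ , weaken (merge-⊑ˡ {Δ = Δ′}) d · weaken (merge-⊑ʳ {Γ = Δ}) d′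
subst⁻ (t [← u ]) V (d ⟦ d′ ⟧)
  with Δ , s , d ← subst⁻ t (exts-valued V) d | Δ′ , s′ , d′ ← subst⁻ u V d′
  with p , s ← under⁻ s =
  _ , merge V s s′ ,
  weaken (λ { zero → p zero ; (suc i) → xs⊆xs++ys _ _ }) d
    ⟦ weaken (merge-⊑ʳ {Γ = Δ ∘ suc}) d′ ⟧

-- Subject expansion

•-valued : ∀ {v : Term X} → Value v → Valued (v • var)
•-valued V zero    = V
•-valued V (suc i) = var i

❴❵⁻ : ∀ t {v} → Value v → Γ ⊢ t ❴ v ❵ ∶ B → ∃[ A ] Γ ⊢ v ∶ A × A • Γ ⊢ t ∶ B
❴❵⁻ {Γ} t {v} V d
  with Δ , s , d ←
    subst⁻ t (•-valued V) (transport (Γ ⊢_∶ _) (❴❵-subst t v) d) =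
  Δ zero , s zero , weaken mono d
  where
  mono : Δ ⊑ Δ zero • Γ
  mono zero    = id
  -- The other indices are replaced by variables, whose typing bounds the demand by `Γ`.
  mono (suc i) with var p ← s (suc i) = p

-- The last component keeps the derivations for the arguments of `L`, so that another term typed in
-- the inner environment `Δ` can be plugged in.
⟨⟩ˢ⁻ : ∀ L {t} → Γ ⊢ L ⟨ t ⟩ˢ ∶ A →
       ∃[ Δ ] Δ ⊢ t ∶ A × (Δ ∘ (depth L +_) ⊑ Γ) ×
              (∀ u {B} → Δ ⊢ u ∶ B → Γ ⊢ L ⟨ u ⟩ˢ ∶ B)
⟨⟩ˢ⁻ □          d          = _ , d , (λ _ → id) , λ _ d → d
⟨⟩ˢ⁻ (L [← s ]) (d ⟦ d′ ⟧) with Δ , d , p , plug ← ⟨⟩ˢ⁻ L d =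
  -- The goal has `suc (depth L + i)` where the induction hypothesis has `depth L + suc i`.
  Δ , d , (λ i → p (suc i) ∘ ⊆-reflexive (cong Δ (sym (+-suc (depth L) i)))) ,
  λ u d → plug u d ⟦ d′ ⟧

-- An ES and a β-redex are typed from the same premises, which settles `m`; for `e`,
-- anti-substitution finds a type of `v`, and `L` is rebuilt around `v`.
↦⁻ : ∀ {t u} → t ↦ u → Γ ⊢ u ∶ A → Γ ⊢ t ∶ A
↦⁻ (m L {t} {u}) d with Δ , d ⟦ d′ ⟧ , p , plug ← ⟨⟩ˢ⁻ L d =
  plug (ƛ t) (d ∷ lam) · rename⁻ p u d′
↦⁻ (e L {t} {v} V) d with Δ , d , p , plug ← ⟨⟩ˢ⁻ L d
  with A , d′ , d ← ❴❵⁻ (rename (ext (depth L +_)) t) V d =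
  rename⁻ (•-∘-ext p) t d ⟦ plug v d′ ⟧

ctx⁻ : ∀ C {t u} → t ↦ u → Γ ⊢ C ⟨ u ⟩ ∶ A → Γ ⊢ C ⟨ t ⟩ ∶ A
ctx⁻ □          r d          = ↦⁻ r d
ctx⁻ (ƛ C)      r lam        = lam
ctx⁻ (ƛ C)      r (d ∷ ds)   = ctx⁻ C r d ∷ ctx⁻ (ƛ C) r ds
ctx⁻ (C ·ˡ s)   r (d · d′)   = ctx⁻ C r d · d′
ctx⁻ (s ·ʳ C)   r (d · d′)   = d · ctx⁻ C r d′
ctx⁻ (C [← s ]ˡ) r (d ⟦ d′ ⟧) = ctx⁻ C r d ⟦ d′ ⟧
ctx⁻ (s [← C ]ʳ) r (d ⟦ d′ ⟧) = d ⟦ ctx⁻ C r d′ ⟧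

⟶*⁻ : ∀ {t u} → t ⟶* u → Γ ⊢ u ∶ A → Γ ⊢ t ∶ A
⟶*⁻ ε                  d = d
⟶*⁻ (closure C r ◅ rs) d = ctx⁻ C r (⟶*⁻ rs d)

-- Realizability in Plotkin theories

⌊_⌋ : Term vsc → Term plot
⌊ var i ⌋    = var i
⌊ ƛ t ⌋      = ƛ ⌊ t ⌋
⌊ t · u ⌋    = ⌊ t ⌋ · ⌊ u ⌋
⌊ t [← u ] ⌋ = (ƛ ⌊ t ⌋) · ⌊ u ⌋

⌊⌈_⌉⌋ : ∀ (t : Term plot) → ⌊ ⌈ t ⌉ ⌋ ≡ t
⌊⌈ var i ⌉⌋ = refl
⌊⌈ ƛ t ⌉⌋   = cong ƛ_ ⌊⌈ t ⌉⌋
⌊⌈ t · u ⌉⌋ = cong₂ _·_ ⌊⌈ t ⌉⌋ ⌊⌈ u ⌉⌋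

module _ {_≈_ : Rel (Term plot) ℓ} (theory : IsTheory _≈_) where
  open IsTheory theory
  open IsEquivalence isEquivalence
    renaming (refl to ≈-refl; sym to ≈-sym; trans to ≈-trans)

  ·-cong : ∀ {t t′ u u′} → t ≈ t′ → u ≈ u′ → (t · u) ≈ (t′ · u′)
  ·-cong {t′ = t′} {u} p q =
    ≈-trans (contextual (□ ·ˡ u) p) (contextual (t′ ·ʳ □) q)

  -- A logical relation on values in which equality in the theory replaces evaluation. Each list
  -- ends with the condition of being a value, so realizers of any type are values.
  Realizes : Term plot → Type → Set ℓ
  Realizes v []             = Lift ℓ (Value v)
  Realizes v ((A ⇒ B) ∷ As) =
    (∀ w → Realizes w A → ∃[ r ] (v · w) ≈ r × Realizes r B) × Realizes v As

  realizer-value : ∀ {v} A → Realizes v A → Value v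
  realizer-value []             (lift V) = V
  realizer-value ((A ⇒ B) ∷ As) (_ , R)  = realizer-value As R

  realizer-apply : ∀ {v C} → Realizes v C → (A ⇒ B) ∈ C →
                   ∀ w → Realizes w A → ∃[ r ] (v · w) ≈ r × Realizes r B
  realizer-apply {C = (_ ⇒ _) ∷ _} (R , _) (here refl) = R
  realizer-apply {C = (_ ⇒ _) ∷ _} (_ , R) (there i)   = realizer-apply R i

  realizer-⊆ : ∀ {v} A {B} → A ⊆ B → Realizes v B → Realizes v A
  realizer-⊆ []             p R = lift (realizer-value _ R)
  realizer-⊆ ((_ ⇒ _) ∷ As) p R =
    realizer-apply R (p (here refl)) , realizer-⊆ As (p ∘ there) R

  •-realizes : ∀ {v σ} → Realizes v A → (∀ i → Realizes (σ i) (Γ i)) →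
               ∀ i → Realizes ((v • σ) i) ((A • Γ) i)
  •-realizes R S zero    = R
  •-realizes R S (suc i) = S i

  β-exts : ∀ (t : Term plot) {σ v r} → Value v → subst (v • σ) t ≈ r →
           (subst σ (ƛ t) · v) ≈ r
  β-exts t {σ} {v} V p =
    ≈-trans (reduction (closure □ (β V)))
      (transport (_≈ _) (sym (exts-❴❵ σ t v)) p)

  -- Arguments are first equated with realizers, which are values, so that Plotkin's β can fire;
  -- this covers an ES too, read as a β-redex.
  adequacy : ∀ {t σ} → (∀ i → Realizes (σ i) (Γ i)) → Γ ⊢ t ∶ A →
             ∃[ r ] subst σ ⌊ t ⌋ ≈ r × Realizes r A
  -- All arrows of an intersection must be realized by one and the same term, so here the
  -- abstraction itself is the realizer, not some `r` equated with it.
  adequacy-ƛ : ∀ {t σ} → (∀ i → Realizes (σ i) (Γ i)) → Γ ⊢ ƛ t ∶ A →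
               Realizes (subst σ ⌊ ƛ t ⌋) A
  adequacy S (var p)             = _ , ≈-refl , realizer-⊆ _ p (S _)
  adequacy S d@(lam {t})         = _ , ≈-refl , adequacy-ƛ {t = t} S d
  adequacy S d@(_∷_ {t = t} _ _) = _ , ≈-refl , adequacy-ƛ {t = t} S d
  adequacy S (d · d′)
    with r , p , R , _ ← adequacy S d | w , q , W ← adequacy S d′
    with s , p′ , R′ ← R w W = s , ≈-trans (·-cong p q) p′ , R′
  adequacy {σ = σ} S (_⟦_⟧ {A} {t = t} d d′)
    with w , q , W ← adequacy S d′
    with r , p , R ← adequacy (•-realizes W S) d =
    r , ≈-trans (contextual (subst σ (ƛ ⌊ t ⌋) ·ʳ □) q)
          (β-exts ⌊ t ⌋ (realizer-value A W) p) , R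
  adequacy-ƛ S lam = lift (lam _)
  adequacy-ƛ S (_∷_ {A} {t = t} d ds) =
    (λ w W → let r , p , R = adequacy (•-realizes W S) d
             in r , β-exts ⌊ t ⌋ (realizer-value A W) p , R) ,
    adequacy-ƛ S ds

  value-in-plot : ∀ {t v} → Value v → t ⟶* v → ∃[ w ] Value w × ⌊ t ⌋ ≈ w
  value-in-plot {t} V rs
    -- Variables are values, so they realize `[]` and the identity substitution is admissible for
    -- open `t`.
    with w , p , lift W ← adequacy {Γ = λ _ → []} (λ i → lift (var i))
                            (⟶*⁻ rs (value-[] V)) =
    w , W , transport (_≈ w) (subst-var ⌊ t ⌋) p

-- Testing contexts

testing-∘ : ∀ {T′ T} → Testing T′ → Testing T → ∀ t →
            ∃[ T″ ] Testing T″ × T″ ⟨ t ⟩ ≡ T′ ⟨ T ⟨ t ⟩ ⟩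
testing-∘ □          T t = _ , T , refl
testing-∘ (bind T′ u) T t with _ , T″ , eq ← testing-∘ T′ T t =
  _ , bind T″ u , cong (λ s → (ƛ s) · u) eq
testing-∘ (app T′ u)  T t with _ , T″ , eq ← testing-∘ T′ T t =
  _ , app T″ u , cong (_· u) eq

-- Used contrapositively: testing contexts compose, hence preserve inscrutability.
scrutable-testing⁻ : ∀ {T} → Testing T → (t u : Term X) → ⌈ u ⌉ ≡ T ⟨ ⌈ t ⌉ ⟩ →
                     Scrutable u → Scrutable t
scrutable-testing⁻ isT t u eq (T′ , isT′ , v , V , rs)
  with T″ , isT″ , eq′ ← testing-∘ isT′ isT ⌈ t ⌉ =
  T″ , isT″ , v , V ,
  transport (_⟶* v) (sym (trans eq′ (cong (T′ ⟨_⟩) (sym eq)))) rs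

-- The arguments of `T` may contain ES. `C` takes their translations, and its inclusion in the VSC
-- is a testing context `T′` that may differ from `T`.
⌊⌋-testing : ∀ {T} → Testing T → ∃₂ λ (C : Ctx plot) T′ → Testing T′ ×
             (∀ t → ⌊ T ⟨ ⌈ t ⌉ ⟩ ⌋ ≡ C ⟨ t ⟩) × (∀ t → ⌈ C ⟨ t ⟩ ⌉ ≡ T′ ⟨ ⌈ t ⌉ ⟩)
⌊⌋-testing □ = □ , □ , □ , ⌊⌈_⌉⌋ , λ _ → refl
⌊⌋-testing (bind T u) with C , _ , T′ , p , q ← ⌊⌋-testing T =
  (ƛ C) ·ˡ ⌊ u ⌋ , _ , bind T′ ⌈ ⌊ u ⌋ ⌉ ,
  (λ t → cong (λ s → (ƛ s) · ⌊ u ⌋) (p t)) ,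
  (λ t → cong (λ s → (ƛ s) · ⌈ ⌊ u ⌋ ⌉) (q t))
⌊⌋-testing (app T u) with C , _ , T′ , p , q ← ⌊⌋-testing T =
  C ·ˡ ⌊ u ⌋ , _ , app T′ ⌈ ⌊ u ⌋ ⌉ ,
  (λ t → cong (_· ⌊ u ⌋) (p t)) , (λ t → cong (_· ⌈ ⌊ u ⌋ ⌉) (q t))

⌈_⌉-vsc : ∀ (t : Term vsc) → ⌈ t ⌉ ≡ t
⌈ var i ⌉-vsc    = refl
⌈ ƛ t ⌉-vsc      = cong ƛ_ ⌈ t ⌉-vsc
⌈ t · u ⌉-vsc    = cong₂ _·_ ⌈ t ⌉-vsc ⌈ u ⌉-vsc
⌈ t [← u ] ⌉-vsc = cong₂ _[←_] ⌈ t ⌉-vsc ⌈ u ⌉-vsc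

⟶*⇒≈ : {_≈_ : Rel (Term X) ℓ} → IsTheory _≈_ → ∀ {t u} → t ⟶* u → t ≈ u
⟶*⇒≈ theory = go
  where
  open IsTheory theory
  open IsEquivalence isEquivalence renaming (refl to ≈-refl; trans to ≈-trans)
  go : ∀ {t u} → t ⟶* u → _
  go ε        = ≈-refl
  go (r ◅ rs) = ≈-trans (reduction r) (go rs)

-- In the VSC the testing context itself serves, as the theory contains reduction. In Plotkin's
-- calculus it is translated, and realizability supplies the value.
scrutable⇒value : {_≈_ : Rel (Term X) ℓ} → IsTheory _≈_ → ∀ {t} → Scrutable t →
                  ∃₂ λ C v → Value v × (C ⟨ t ⟩) ≈ v ×
                             (∀ u → Inscrutable u → Inscrutable (C ⟨ u ⟩))
scrutable⇒value {plot} {_≈_ = _≈_} theory {t} (T , isT , _ , V , rs)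
  with w , W , p ← value-in-plot theory V rs | C , _ , T′ , q , q′ ← ⌊⌋-testing isT =
  C , w , W , transport (_≈ w) (q t) p ,
  λ u i s → i (scrutable-testing⁻ T′ u (C ⟨ u ⟩) (q′ u) s)
scrutable⇒value {vsc} {_≈_ = _≈_} theory {t} (T , isT , v , V , rs) =
  T , v , V , transport (λ s → (T ⟨ s ⟩) ≈ v) ⌈ t ⌉-vsc (⟶*⇒≈ theory rs) ,
  λ u i s → i (scrutable-testing⁻ isT u (T ⟨ u ⟩)
    (trans ⌈ T ⟨ u ⟩ ⌉-vsc (cong (T ⟨_⟩) (sym ⌈ u ⌉-vsc))) s)

-- Theories

discard-value : {_≈_ : Rel (Term X) ℓ} → IsTheory _≈_ →
                ∀ t {v} → Value v → ((ƛ rename suc t) · v) ≈ t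
discard-value {plot} {_≈_ = _≈_} theory t {v} V =
  transport (((ƛ rename suc t) · v) ≈_) (suc-❴❵ t v)
    (reduction (closure □ (β {rename suc t} V)))
  where open IsTheory theory
discard-value {vsc} {_≈_ = _≈_} theory t {v} V =
  IsEquivalence.trans isEquivalence
    (reduction (closure □ (m □ {rename suc t} {v})))
    (transport ((rename suc t [← v′ ]) ≈_) (rename-❴❵ (λ _ → refl) t v′)
      (reduction (closure □ (e □ {rename suc t} {v′} (rename-value V)))))
  where
  open IsTheory theory
  -- Rule `m` leaves this renaming on the argument even at depth 0.
  v′ = rename (0 +_) v

module _ {_≈_ : Rel (Term X) ℓ} (theory : IsTheory _≈_) where
  open IsTheory theory
  open IsEquivalence isEquivalence
    renaming (refl to ≈-refl; sym to ≈-sym; trans to ≈-trans)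

  -- A value v equated with Ω makes every t equal to (λx.t) Ω, hence to Ω.
  value≈Ω⇒inconsistent : (∀ t → ((ƛ t) · Ω) ≈ Ω) → ∀ {v} → Value v → v ≈ Ω →
                         Inconsistent _≈_
  value≈Ω⇒inconsistent absorb {v} V v≈Ω t u = ≈-trans (≈Ω t) (≈-sym (≈Ω u))
    where
    ≈Ω : ∀ t → t ≈ Ω
    ≈Ω t = ≈-trans (≈-sym (discard-value theory t V))
             (≈-trans (contextual ((ƛ rename suc t) ·ʳ □) v≈Ω) (absorb _))

  unsolvables-equated⇒inconsistent : Equates _≈_ Unsolvable → Inconsistent _≈_
  unsolvables-equated⇒inconsistent eq =
    value≈Ω⇒inconsistent
      (λ t → eq ((ƛ t) · Ω) Ω
               (diverges⇒unsolvable ((ƛ t) · Ω) 0 (inj₁ (inj₂ (inj₂ (refl , refl)))))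
               Ω-unsolvable)
      (lam Ω)
      -- The value `ƛ Ω` diverges once it has one argument, hence the index 1.
      (eq (ƛ Ω) Ω (diverges⇒unsolvable {X} (ƛ Ω) 1 (inj₂ (refl , refl))) Ω-unsolvable)
    where
    Ω-unsolvable : Unsolvable {X} Ω
    Ω-unsolvable = diverges⇒unsolvable {X} Ω 0 (inj₂ (refl , refl))

  scrutable≈inscrutable⇒inconsistent :
    ScrutableTheory _≈_ →
    (∃₂ λ t u → Scrutable t × Inscrutable u × t ≈ u) → Inconsistent _≈_
  scrutable≈inscrutable⇒inconsistent eq (t , u , t-scrutable , u-inscrutable , t≈u)
    with C , v , V , C⟨t⟩≈v , inscrutable ← scrutable⇒value theory t-scrutable =
    value≈Ω⇒inconsistent
      (λ t → eq ((ƛ t) · Ω) Ω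
               (diverges⇒inscrutable ((ƛ t) · Ω) (inj₁ (inj₂ (inj₂ (refl , refl)))))
               Ω-inscrutable)
      V
      (≈-trans (≈-sym C⟨t⟩≈v)
        (≈-trans (contextual C t≈u)
          (eq (C ⟨ u ⟩) Ω (inscrutable u u-inscrutable) Ω-inscrutable)))
    where
    Ω-inscrutable : Inscrutable {X} Ω
    Ω-inscrutable = diverges⇒inscrutable {X} Ω (inj₂ (refl , refl))

theorem6p5 : ∀ (X : Calculus) ℓ →
    (∀ (_≈_ : Rel (Term X) ℓ) → IsTheory _≈_ → ScrutableTheory _≈_ →
    (∃₂ λ t u → Scrutable t × Inscrutable u × t ≈ u) → Inconsistent _≈_)
    × (ExcludedMiddle ℓ →
    ∀ (_≈_ : Rel (Term X) ℓ) → IsTheory _≈_ → ScrutableTheory _≈_ →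
    ¬ SemiScrutable _≈_ → Inconsistent _≈_)
    × (∀ (_≈_ : Rel (Term X) ℓ) → IsTheory _≈_ →
    Equates _≈_ Unsolvable → Inconsistent _≈_)
theorem6p5 X ℓ = pair , classical , λ _ → unsolvables-equated⇒inconsistent
  where
  pair : ∀ (_≈_ : Rel (Term X) ℓ) → IsTheory _≈_ → ScrutableTheory _≈_ →
         (∃₂ λ t u → Scrutable t × Inscrutable u × t ≈ u) → Inconsistent _≈_
  pair _ = scrutable≈inscrutable⇒inconsistent

  classical : ExcludedMiddle ℓ →
              ∀ (_≈_ : Rel (Term X) ℓ) → IsTheory _≈_ → ScrutableTheory _≈_ →
              ¬ SemiScrutable _≈_ → Inconsistent _≈_
  -- Deciding this one equation is enough: were it false, no scrutable term could equal an
  -- inscrutable one, since such a pair would prove it.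
  classical em _≈_ theory scrutable ¬semi t u with em {t ≈ u}
  ... | yes t≈u = t≈u
  ... | no  t≉u = contradiction
    (λ t′ u′ s i t′≈u′ → t≉u (pair _≈_ theory scrutable (t′ , u′ , s , i , t′≈u′) t u))
    ¬semi
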